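{- For every connected graph $G$ the following assertions are equivalent: (i) The end space of $G$ is not second countable. (ii) $G$ has an uncountable star-decomposition of finite adhesion such that in every leaf part there lives an end of $G$. In particular, the end space of $G$ contains uncountably many pairwise disjoint open sets.
   Context: The "in particular" clause in (ii) records a consequence of the existence of such a star-decomposition; the open sets are understood to be non-empty. Graphs may be infinite of any cardinality. A ray is a one-way infinite path. Two rays in $G$ are equivalent if no finite set of vertices separates them; the equivalence classes are the ends of $G$, and $\Omega(G)$ is the set of ends. For finite $X\subseteq V(G)$ and $\omega\in\Omega(G)$, $C(X,\omega)$ is the unique component of $G-X$ that contains a tail of every ray in $\omega$. The end space of $G$ is $\Omega(G)$ with the topology having as a basis all sets $\Omega(X,C)=\{\omega\in\Omega(G): C(X,\omega)=C\}$, with $X\subseteq V(G)$ finite and $C$ a component of $G-X$. Second countable means having a countable base. A tree-decomposition of $G$ is a pair $(T,\mathcal V)$ of a tree $T$ and a family $\mathcal V=(V_t)_{t\in V(T)}$ of parts $V_t\subseteq V(G)$ such that $V(G)=\bigcup_t V_t$, every edge of $G$ has both endvertices in some $V_t$, and $V_{t_1}\cap V_{t_3}\subseteq V_{t_2}$ whenever $t_2$ lies on the path $t_1Tt_3$. It has finite adhesion if $V_{t_1}\cap V_{t_2}$ is finite for every edge $t_1t_2$ of $T$. An uncountable star-decomposition is a tree-decomposition whose tree is a star $K_{1,\kappa}$ with $\kappa$ an uncountable cardinal; the parts of its leaves are the leaf parts. If $(T,\mathcal V)$ has finite adhesion, an end lives in a part $V_t$ if some (equivalently, every) ray in that end has infinitely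 many vertices in $V_t$. -}

module Defs where

open import Level using (Level; _⊔_) renaming (suc to lsuc)
open import Data.List.Base using (List; []; _∷_; _++_; applyUpTo)
open import Data.List.Membership.Propositional using (_∈_; _∉_)
open import Data.List.Membership.Propositional.Properties using (∈-++⁺ˡ; ∈-++⁺ʳ; ∈-applyUpTo⁺)
open import Data.List.Relation.Unary.All as All using (All; []; _∷_)
open import Data.List.Relation.Unary.AllPairs using ([]; _∷_)
open import Data.List.Relation.Unary.Any using (here; there)
open import Data.List.Relation.Unary.Unique.Propositional using (Unique)
open import Data.Maybe.Base using (Maybe; just; nothing)
open import Data.Nat.Base using (ℕ; suc; _+_; _≤_; s≤s; _≤′_; ≤′-refl; ≤′-step)
open import Data.Nat.Properties using (≤-refl; ≤-trans; ≤-total; ≮⇒≥; ≤⇒≤′; ≤′⇒≤; n≤1+n; m≤m+n; m≤n+m; <⇒≢)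
open import Data.Product.Base using (Σ-syntax; ∃; ∃-syntax; _×_; _,_)
open import Data.Sum.Base using (inj₁; inj₂)
open import Function.Bundles using (_↣_)
open import Function.Definitions using (Injective)
open import Relation.Binary.Bundles using (Setoid)
open import Relation.Binary.Construct.Closure.ReflexiveTransitive using (Star; ε; _◅_)
open import Relation.Binary.Core using (Rel)
open import Relation.Binary.Definitions using (Reflexive; Symmetric; Transitive)
open import Relation.Binary.PropositionalEquality using (_≡_; _≢_; refl; sym; trans)
open import Relation.Nullary.Negation using (¬_)
open import Relation.Unary using (Pred; Satisfiable; _⊆_; _∩_; Empty)

Countable : ∀ {a} → Set a → Set a
Countable A = A ↣ ℕ

Uncountable : ∀ {a} → Set a → Set a
Uncountable A = ¬ Countable A

Finite : ∀ {a p} {A : Set a} → Pred A p → Set (a ⊔ p)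
Finite P = ∃[ xs ] (∀ {x} → P x → x ∈ xs)

record Graph (ℓ : Level) : Set (lsuc ℓ) where
  infix 4 _~_
  field
    V      : Set ℓ
    _~_    : Rel V ℓ
    ~-sym  : Symmetric _~_
    ~-irr  : ∀ {v} → ¬ (v ~ v)

module _ {ℓ} (G : Graph ℓ) where
  open Graph G

  Walk : Rel V ℓ
  Walk = Star _~_

  vertices : ∀ {u v} → Walk u v → List V
  vertices {u} ε       = u ∷ []
  vertices {u} (_ ◅ w) = u ∷ vertices w

  IsPath : ∀ {u v} → Walk u v → Set ℓ
  IsPath w = Unique (vertices w)

  WalkIn : ∀ {p} → Pred V p → V → V → Set (ℓ ⊔ p)
  WalkIn P u v = Σ[ w ∈ Walk u v ] All P (vertices w)

  ConnectedOn : ∀ {p} → Pred V p → Set (ℓ ⊔ p)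
  ConnectedOn P = Satisfiable P × (∀ {u v} → P u → P v → WalkIn P u v)

  Connected : Set ℓ
  Connected = V × (∀ u v → Walk u v)

  -- A cycle is a path u ~ x ~ y … v with at least two edges, together with
  -- an edge between its endvertices.
  Acyclic : Set ℓ
  Acyclic = ∀ {u x y v} (e : u ~ x) (f : x ~ y) (w : Walk y v) →
    IsPath (e ◅ f ◅ w) → ¬ (v ~ u)

  -- C is the vertex set of a component, i.e. of a maximal connected
  -- subgraph, of G − X. The finite set X is given by a list of its elements.
  record IsComponent (X : List V) (C : Pred V ℓ) : Set (lsuc ℓ) where
    field
      avoids    : ∀ {v} → C v → v ∉ X
      connected : ConnectedOn C
      maximal   : ∀ (D : Pred V ℓ) → (∀ {v} → D v → v ∉ X) →
                  ConnectedOn D → C ⊆ D → D ⊆ C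

  record Ray : Set ℓ where
    field
      at        : ℕ → V
      adjacent  : ∀ n → at n ~ at (suc n)
      injective : Injective _≡_ _≡_ at

  open Ray

  OnRay : Ray → Pred V ℓ
  OnRay R v = ∃[ n ] at R n ≡ v

  -- Every walk contains a path between its endvertices, so it makes no
  -- difference that walks are used instead of paths.
  Separates : List V → Ray → Ray → Set ℓ
  Separates X R S = ∀ {i j} → ¬ WalkIn (_∉ X) (at R i) (at S j)

  infix 4 _≈_
  _≈_ : Rel Ray ℓ
  R ≈ S = ∀ X → ¬ Separates X R S

  private
    join : ∀ {p} {P : Pred V p} {u v x} → WalkIn P u v → WalkIn P v x → WalkIn P u x
    join (ε     , _     ) w′ = w′
    join (e ◅ w , p ∷ ps) w′ = let w″ , qs = join (w , ps) w′ in e ◅ w″ , p ∷ qs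

    start : ∀ {p} {P : Pred V p} {u v} → WalkIn P u v → P u
    start (ε     , p ∷ _) = p
    start (_ ◅ _ , p ∷ _) = p

    flip : ∀ {p} {P : Pred V p} {u v} → WalkIn P u v → WalkIn P v u
    flip (ε     , ps    ) = ε , ps
    flip (e ◅ w , p ∷ ps) =
      join (flip (w , ps)) (~-sym e ◅ ε , start (w , ps) ∷ p ∷ [])

    widen : ∀ {p q} {P : Pred V p} {Q : Pred V q} {u v} → P ⊆ Q →
      WalkIn P u v → WalkIn Q u v
    widen P⊆Q (w , ps) = w , All.map P⊆Q ps

    along : ∀ {p} {P : Pred V p} (R : Ray) {m n} → m ≤′ n →
      (∀ {k} → m ≤ k → P (at R k)) → WalkIn P (at R m) (at R n)
    along R ≤′-refl       ps = ε , ps ≤-refl ∷ []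
    along R (≤′-step {n} m≤n) ps = join (along R m≤n ps)
      (adjacent R n ◅ ε , ps (≤′⇒≤ m≤n) ∷ ps (≤-trans (≤′⇒≤ m≤n) (n≤1+n n)) ∷ [])

    within-tail : ∀ {p} {P : Pred V p} (R : Ray) {m i j} →
      (∀ {k} → m ≤ k → P (at R k)) → m ≤ i → m ≤ j → WalkIn P (at R i) (at R j)
    within-tail R {m} {i} {j} ps m≤i m≤j with ≤-total i j
    ... | inj₁ i≤j = along R (≤⇒≤′ i≤j) λ i≤k → ps (≤-trans m≤i i≤k)
    ... | inj₂ j≤i = flip (along R (≤⇒≤′ j≤i) λ j≤k → ps (≤-trans m≤j j≤k))

    tail-avoids : ∀ (R : Ray) X → ¬ ¬ (∃[ m ] ∀ {k} → m ≤ k → at R k ∉ X)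
    tail-avoids R []      ¬tail = ¬tail (0 , λ _ ())
    tail-avoids R (x ∷ X) ¬tail = tail-avoids R X λ (m , avoid) →
      ¬tail (m , λ
        { m≤k (there k∈X) → avoid m≤k k∈X
        ; {k} m≤k (here k≡x) → ¬tail (suc (m + k) , λ
            { {l} l> (there l∈X) → avoid (≤-trans (m≤m+n m k) (≤-trans (n≤1+n _) l>)) l∈X
            ; {l} l> (here l≡x) → <⇒≢ (≤-trans (s≤s (m≤n+m k m)) l>)
                (injective R (trans k≡x (sym l≡x))) }) })

  ≈-refl : Reflexive _≈_
  ≈-refl {R} X sep = tail-avoids R X λ (m , avoid) →
    sep {m} {m} (ε , avoid ≤-refl ∷ [])

  ≈-sym : Symmetric _≈_
  ≈-sym R≈S X sep = R≈S X λ w → sep (flip w)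

  ≈-trans : Transitive _≈_
  ≈-trans {R} {S} {T} R≈S S≈T X sep = tail-avoids S X λ (m , avoid) →
    let Y = X ++ applyUpTo (at S) m
        late : ∀ {i} → at S i ∉ Y → m ≤ i
        late = λ i∉Y → ≮⇒≥ λ i<m → i∉Y (∈-++⁺ʳ X (∈-applyUpTo⁺ (at S) i<m))
        shrink : (_∉ Y) ⊆ (_∉ X)
        shrink = λ v∉Y v∈X → v∉Y (∈-++⁺ˡ v∈X)
    in R≈S Y λ w₁ → S≈T Y λ w₂ →
      sep (join (widen shrink w₁)
          (join (within-tail S avoid (late (start (flip w₁))) (late (start w₂)))
                (widen shrink w₂)))

  -- An end is a class of equivalent rays; it is represented by any of its
  -- rays, and R ≈ ω reads "R belongs to the end ω".
  Ends : Setoid ℓ ℓ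
  Ends = record
    { Carrier       = Ray
    ; _≈_           = _≈_
    ; isEquivalence = record { refl = λ {R} → ≈-refl {R}
                             ; sym = λ {R} {S} → ≈-sym {R} {S}
                             ; trans = λ {R} {S} {T} → ≈-trans {R} {S} {T} }
    }

  End : Set ℓ
  End = Setoid.Carrier Ends

  HasTailIn : Pred V ℓ → Pred Ray ℓ
  HasTailIn C R = ∃[ m ] (∀ {k} → m ≤ k → C (at R k))

  -- For a component C of G − X, the set Ω(X,C) of the ends ω with
  -- C(X,ω) = C. It does not mention X: C(X,ω) is the only component of G − X
  -- containing a tail of every ray in ω, so that C(X,ω) = C just says that C
  -- contains these tails.
  Ω : Pred V ℓ → Pred End ℓ
  Ω C ω = ∀ {R} → R ≈ ω → HasTailIn C R

  -- The unions of sets Ω(X,C). Such a union is automatically closed under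
  -- the equality of Ends, since every Ω(X,C) is.
  Open : Pred (Pred End ℓ) (lsuc ℓ)
  Open U = ∀ {ω} → U ω →
    ∃[ X ] ∃[ C ] IsComponent X C × Ω C ω × Ω C ⊆ U

  IsBase : {I : Set} → (I → Pred End ℓ) → Set (lsuc ℓ)
  IsBase B = (∀ i → Open (B i)) ×
    (∀ U → Open U → ∀ {ω} → U ω → ∃[ i ] B i ω × B i ⊆ U)

  SecondCountable : Set (lsuc ℓ)
  SecondCountable = Σ[ I ∈ Set ] Countable I × ∃[ B ] IsBase {I} B

  UncountablyManyDisjointOpens : Set (lsuc ℓ)
  UncountablyManyDisjointOpens =
    Σ[ K ∈ Set ℓ ] Uncountable K × Σ[ U ∈ (K → Pred End ℓ) ]
      (∀ k → Open (U k)) ×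
      (∀ k → Satisfiable (U k)) ×
      (∀ {k l} → k ≢ l → Empty (U k ∩ U l))

record Tree (ℓ : Level) : Set (lsuc ℓ) where
  field
    graph     : Graph ℓ
    connected : Connected graph
    acyclic   : Acyclic graph

  open Graph graph public renaming (V to Node)

module _ {ℓ} (G : Graph ℓ) where
  open Graph G

  record TreeDecomposition (T : Tree ℓ) : Set (lsuc ℓ) where
    open Tree T using (Node) renaming (graph to ∣T∣; _~_ to _~ᵀ_)
    field
      part        : Node → Pred V ℓ
      covers      : ∀ v → ∃[ t ] part t v
      coversEdges : ∀ {u v} → u ~ v → ∃[ t ] part t u × part t v
      between     : ∀ {t₁ t₂ t₃} (p : Walk ∣T∣ t₁ t₃) → IsPath ∣T∣ p →
                    t₂ ∈ vertices ∣T∣ p → part t₁ ∩ part t₃ ⊆ part t₂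

    FiniteAdhesion : Set ℓ
    FiniteAdhesion = ∀ {t₁ t₂} → t₁ ~ᵀ t₂ → Finite (part t₁ ∩ part t₂)

  LivesIn : End G → Pred V ℓ → Set ℓ
  LivesIn ω P = Σ[ R ∈ Ray G ] _≈_ G R ω × ¬ Finite (OnRay G R ∩ P)

-- In K₁,κ the centre is nothing and the leaves are just k.
data StarAdj {ℓ} {K : Set ℓ} : Rel (Maybe K) ℓ where
  out : ∀ {k} → StarAdj nothing (just k)
  inn : ∀ {k} → StarAdj (just k) nothing

K₁,_ : ∀ {ℓ} → Set ℓ → Tree ℓ
K₁, K = record { graph = star ; connected = nothing , walk ; acyclic = acyclic }
  where
  star : Graph _
  star = record
    { V     = Maybe K
    ; _~_   = StarAdj
    ; ~-sym = λ { out → inn ; inn → out }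
    ; ~-irr = λ ()
    }

  walk : ∀ s t → Walk star s t
  walk nothing  nothing  = ε
  walk nothing  (just _) = out ◅ ε
  walk (just _) nothing  = inn ◅ ε
  walk (just _) (just _) = inn ◅ out ◅ ε

  acyclic : Acyclic star
  acyclic out inn ε         ((_ ∷ u≢y ∷ _) ∷ _) _ = u≢y refl
  acyclic out inn (out ◅ _) ((_ ∷ u≢y ∷ _) ∷ _) _ = u≢y refl
  acyclic inn out (inn ◅ ε)       (_ ∷ (_ ∷ x≢z ∷ _) ∷ _) _ = x≢z refl
  acyclic inn out (inn ◅ out ◅ _) (_ ∷ (_ ∷ x≢z ∷ _) ∷ _) _ = x≢z refl

HasUncountableStarDecomposition : ∀ {ℓ} → Graph ℓ → Set (lsuc ℓ)
HasUncountableStarDecomposition {ℓ} G =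
  Σ[ K ∈ Set ℓ ] Uncountable K × Σ[ D ∈ TreeDecomposition G (K₁, K) ]
    let open TreeDecomposition D in
    FiniteAdhesion × (∀ k → ∃[ ω ] LivesIn G ω (part (just k)))

-- Call a countable set of vertices dense if it meets every region, that is every
-- component of G − X for finite X, which contains a ray. A dense set closed under
-- connecting its vertices by walks outside finite subsets yields a countable base.
-- If there is no uncountable star-decomposition, every family of pairwise
-- disjoint and non-adjacent regions with rays is countable, and a dense set is
-- built by induction on |X|: to a countable set meeting the regions with |X| < n,
-- add ω times the roots and boundaries of a maximal such family among the
-- regions with |X| ≤ n that are still avoided. A region avoided to the end would
-- lie in a member of each of these families, which is impossible by the
-- minimality of n. Conversely, the leaf parts of an uncountable star-decomposition
-- give uncountably many disjoint non-empty open sets.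

module Submission where

open import Defs
open import Axiom.DoubleNegationElimination using (em⇒dne)
open import Axiom.ExcludedMiddle using (ExcludedMiddle)
open import Axiom.Extensionality.Propositional using (Extensionality)
open import Axiom.UniquenessOfIdentityProofs.WithK using (uip)
open import Data.Bool.Base using (Bool; true; false)
open import Data.Empty using (⊥; ⊥-elim)
open import Data.List.Base using (List; []; _∷_; length; filter; applyUpTo; _++_)
open import Data.List.Membership.Propositional using (_∈_; _∉_)
open import Data.List.Membership.Propositional.Properties
  using (∈-filter⁺; ∈-filter⁻; ∈-applyUpTo⁺; ∈-++⁺ˡ; ∈-++⁺ʳ)
open import Data.List.Properties using (filter-notAll)
open import Data.List.Relation.Unary.All as All using (All; []; _∷_)
open import Data.List.Relation.Unary.AllPairs using ([]; _∷_)
open import Data.List.Relation.Unary.Any as Any using (here; there)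
open import Data.Maybe.Base using (Maybe; just; nothing)
open import Data.Nat.Base using (ℕ; zero; suc; _+_; _≤_; _<_; _⊔_; z≤n; s≤s; s≤s⁻¹)
open import Data.Nat.Properties
open import Data.Product.Base using (Σ-syntax; ∃; ∃-syntax; _×_; _,_; proj₁; proj₂)
open import Data.Sum.Base using (_⊎_; inj₁; inj₂; [_,_]′)
open import Function.Base using (_∘_; id; case_of_)
open import Function.Bundles using (_⇔_; _↣_; Injection; mk⇔; mk↣)
open import Level using (Lift)
open import Relation.Binary.Construct.Closure.ReflexiveTransitive using (ε; _◅_)
open import Relation.Binary.Core using (Rel)
open import Relation.Binary.Definitions using (Symmetric)
open import Relation.Binary.PropositionalEquality using (_≡_; _≢_; refl; sym; trans; cong; cong₂; subst)
open import Relation.Nullary using (Dec; yes; no; does; ¬_; ¬?)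
open import Relation.Nullary.Decidable using (dec-true)
open import Relation.Nullary.Negation using (contradiction)
open import Relation.Unary using (Pred)

-- Countable sets as sequences.

nextPair : ℕ × ℕ → ℕ × ℕ
nextPair (zero  , b) = suc b , zero
nextPair (suc a , b) = a , suc b

unpair : ℕ → ℕ × ℕ
unpair zero    = zero , zero
unpair (suc n) = nextPair (unpair n)

-- `unpair` runs through the antidiagonals, each from `(d , 0)` to `(0 , d)`; the recursion follows
-- it backwards.
unpair-surjective : ∀ a b → ∃[ n ] unpair n ≡ (a , b)
unpair-surjective a b = onDiagonal (a + b) b a refl
  where
  onDiagonal : ∀ d b a → a + b ≡ d → ∃[ n ] unpair n ≡ (a , b)
  onDiagonal d (suc b) a eq =
    let n , un≡ = onDiagonal d b (suc a) (trans (sym (+-suc a b)) eq)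
    in suc n , cong nextPair un≡
  onDiagonal (suc d) zero (suc a) eq =
    let n , un≡ = onDiagonal d a zero (trans (sym (+-identityʳ a)) (suc-injective eq))
    in suc n , cong nextPair un≡
  onDiagonal d zero zero eq = zero , refl

module _ {a} {A : Set a} where

  infix 4 _∈ˢ_ _⊆ˢ_

  -- A non-empty countable set is encoded by a sequence of its elements, with repetitions allowed.
  _∈ˢ_ : A → (ℕ → A) → Set a
  x ∈ˢ s = ∃[ n ] s n ≡ x

  _⊆ˢ_ : (ℕ → A) → (ℕ → A) → Set a
  s ⊆ˢ t = ∀ {x} → x ∈ˢ s → x ∈ˢ t

  ⋃ˢ : (ℕ → ℕ → A) → ℕ → A
  ⋃ˢ s n = let i , j = unpair n in s i j

  ⊆-⋃ˢ : ∀ s i → s i ⊆ˢ ⋃ˢ s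
  ⊆-⋃ˢ s i (j , refl) =
    let n , un≡ = unpair-surjective i j
    in n , cong (λ (k , l) → s k l) un≡

  nth : A → List A → ℕ → A
  nth d []       _       = d
  nth d (x ∷ xs) zero    = x
  nth d (x ∷ xs) (suc n) = nth d xs n

  ∈⇒∈ˢnth : ∀ d {x xs} → x ∈ xs → x ∈ˢ nth d xs
  ∈⇒∈ˢnth d (here refl) = zero , refl
  ∈⇒∈ˢnth d (there x∈)  = let n , eq = ∈⇒∈ˢnth d x∈ in suc n , eq

  stage-mono : (s : ℕ → ℕ → A) → (∀ k → s k ⊆ˢ s (suc k)) →
    ∀ {k l} → k ≤ l → s k ⊆ˢ s l
  stage-mono s inc {l = zero}  z≤n x∈ = x∈
  stage-mono s inc {k} {suc l} k≤ x∈ with m≤n⇒m<n∨m≡n k≤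
  ... | inj₁ k<  = inc l (stage-mono s inc (s≤s⁻¹ k<) x∈)
  ... | inj₂ refl = x∈

  All-stage : (s : ℕ → ℕ → A) → (∀ k → s k ⊆ˢ s (suc k)) →
    ∀ {xs} → All (_∈ˢ ⋃ˢ s) xs → ∃[ k ] All (_∈ˢ s k) xs
  All-stage s inc [] = zero , []
  All-stage s inc ((n , refl) ∷ ps) =
    let k , qs = All-stage s inc ps
        i , j  = unpair n
    in i ⊔ k , stage-mono s inc (m≤m⊔n i k) (j , refl)
             ∷ All.map (stage-mono s inc (m≤n⊔m i k)) qs

module _ {a} {A : Set a} where

  listsOfLength : (ℕ → A) → ℕ → ℕ → List A
  listsOfLength s zero    _ = []
  listsOfLength s (suc l) n = let i , j = unpair n in s i ∷ listsOfLength s l j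

  lists : (ℕ → A) → ℕ → List A
  lists s = ⋃ˢ (listsOfLength s)

  ∈-lists : ∀ s {xs} → All (_∈ˢ s) xs → xs ∈ˢ lists s
  ∈-lists s {xs} ps = ⊆-⋃ˢ (listsOfLength s) (length xs) (ofLength ps)
    where
    ofLength : ∀ {xs} → All (_∈ˢ s) xs → xs ∈ˢ listsOfLength s (length xs)
    ofLength [] = zero , refl
    ofLength {x ∷ xs} ((i , si≡) ∷ ps) =
      let j , lj≡ = ofLength ps
          n , un≡ = unpair-surjective i j
      in n , trans (cong (λ (k , l) → s k ∷ listsOfLength s (length xs) l) un≡)
                   (cong₂ _∷_ si≡ lj≡)

Infinite : ∀ {p} → Pred ℕ p → Set p
Infinite S = ∀ m → ∃[ k ] m ≤ k × S k

module Classical (em : ∀ {a} → ExcludedMiddle a) where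

  dne : ∀ {a} {P : Set a} → ¬ ¬ P → P
  dne = em⇒dne em

  module _ {a k} {A : Set a} {K : Set k} (f : K ↣ ℕ) (L : K → List A) (s : ℕ → A) where

    -- Excluded middle inverts the injection `f`. For an `n` outside its image, repeating `s` adds
    -- nothing new; likewise a list is padded with `s 0`.
    row : (n : ℕ) → Dec (∃[ k ] Injection.to f k ≡ n) → ℕ → A
    row n (yes (k , _)) = nth (s 0) (L k)
    row n (no _)        = s

    rows : ℕ → ℕ → A
    rows zero    = s
    rows (suc n) = row n em

    adjoin : ℕ → A
    adjoin = ⋃ˢ rows

    ⊆-adjoin : s ⊆ˢ adjoin
    ⊆-adjoin = ⊆-⋃ˢ rows 0

    ∈-adjoin : ∀ k {x} → x ∈ L k → x ∈ˢ adjoin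
    ∈-adjoin k {x} x∈ = ⊆-⋃ˢ rows (suc (Injection.to f k)) (inRow em)
      where
      inRow : ∀ d → x ∈ˢ row (Injection.to f k) d
      inRow (yes (l , eq)) with refl ← Injection.injective f eq = ∈⇒∈ˢnth (s 0) x∈
      inRow (no ¬k) = contradiction (k , refl) ¬k

  -- Induction on the list: if from some `m` on no index is served by the rest of the list, then `x`
  -- serves arbitrarily large indices.
  pigeonhole : ∀ {a p} {A : Set a} {S : ℕ → A → Set p} xs →
    Infinite (λ k → ∃[ x ] x ∈ xs × S k x) → ∃[ x ] Infinite (λ k → S k x)
  pigeonhole [] inf with () ← proj₁ (proj₂ (proj₂ (proj₂ (inf 0))))
  pigeonhole {S = S} (x ∷ xs) inf with em {P = Infinite (λ k → S k x)}
  ... | yes infₓ = x , infₓ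
  ... | no ¬infₓ = pigeonhole xs λ m → dne λ none → ¬infₓ λ l →
    case inf (m ⊔ l) of λ
      { (k , ml≤k , _ , here refl , Sk) → k , ≤-trans (m≤n⊔m m l) ml≤k , Sk
      ; (k , ml≤k , y , there y∈  , Sk) →
          contradiction (k , ≤-trans (m≤m⊔n m l) ml≤k , y , y∈ , Sk) none }

  -- Maximal independent sets.

  module Maximal (ext : ∀ {a b} → Extensionality a b)
    {a} {A : Set a} (_#_ : Rel A a) (#-sym : Symmetric _#_) where

    -- Subsets are Boolean-valued so that function extensionality alone makes
    -- subsets with the same elements equal.
    Subset : Set a
    Subset = A → Bool

    ⟦_⟧ : ∀ {b p} {B : Set b} → Pred B p → B → Bool
    ⟦ P ⟧ b = does (em {P = P b})

    ⟦⟧⁺ : ∀ {b p} {B : Set b} (P : Pred B p) {b} → P b → ⟦ P ⟧ b ≡ true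
    ⟦⟧⁺ P = dec-true em

    ⟦⟧⁻ : ∀ {b p} {B : Set b} (P : Pred B p) {b} → ⟦ P ⟧ b ≡ true → P b
    ⟦⟧⁻ P {b} eq with em {P = P b}
    ... | yes p = p

    infix 4 _∈ᵇ_ _⊆ᵇ_

    _∈ᵇ_ : A → Subset → Set
    x ∈ᵇ S = S x ≡ true

    _⊆ᵇ_ : Subset → Subset → Set a
    S ⊆ᵇ R = ∀ {x} → x ∈ᵇ S → x ∈ᵇ R

    ⊆ᵇ-antisym : ∀ {S R} → S ⊆ᵇ R → R ⊆ᵇ S → S ≡ R
    ⊆ᵇ-antisym {S} {R} S⊆R R⊆S = ext λ x → bool (S⊆R {x}) (R⊆S {x})
      where
      bool : ∀ {b c} → (b ≡ true → c ≡ true) → (c ≡ true → b ≡ true) → b ≡ c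
      bool {false} {false} f g = refl
      bool {false} {true}  f g = g refl
      bool {true}  f g = sym (f refl)

    Extends : Subset → Pred A a
    Extends S x = ¬ x ∈ᵇ S × (∀ {y} → y ∈ᵇ S → x # y)

    -- The witness stored in the decision serves as the chosen extension. As `em` returns one fixed
    -- decision for each `S`, this acts as a choice function.
    Added : ∀ {S} → Dec (∃ (Extends S)) → Pred A a
    Added (yes (x , _)) y = y ≡ x
    Added (no _)        y = Lift a ⊥

    Added⇒Extends : ∀ {S} (d : Dec (∃ (Extends S))) {x} → Added d x → Extends S x
    Added⇒Extends (yes (_ , e)) refl = e

    Added-unique : ∀ {S} (d : Dec (∃ (Extends S))) {x y} → Added d x → Added d y → x ≡ y
    Added-unique (yes _) refl refl = refl

    Added-exists : ∀ {S} (d : Dec (∃ (Extends S))) → ∃ (Extends S) → ∃ (Added d)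
    Added-exists (yes (x , _)) _ = x , refl
    Added-exists (no ¬e)       e = contradiction e ¬e

    Next : Subset → Pred A a
    Next S x = x ∈ᵇ S ⊎ Added {S} em x

    next : Subset → Subset
    next S = ⟦ Next S ⟧

    -- Families are Boolean-valued too: this keeps `Tower` at level `a` and makes the family of all
    -- its members an admissible argument of `⋃ᵗ`.
    Union : (Subset → Bool) → Pred A a
    Union 𝒮 x = ∃[ S ] 𝒮 S ≡ true × x ∈ᵇ S

    -- Zermelo's tower: the union of all its members is closed under next.
    data Tower : Subset → Set a where
      nextᵗ : ∀ {S} → Tower S → Tower (next S)
      ⋃ᵗ    : ∀ 𝒮 → (∀ {S} → 𝒮 S ≡ true → Tower S) → Tower ⟦ Union 𝒮 ⟧

    ⊆-next : ∀ S → S ⊆ᵇ next S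
    ⊆-next S = ⟦⟧⁺ (Next S) ∘ inj₁

    -- Zermelo's comparability argument, by recursion on both tower proofs; in the successor case it
    -- is applied in both directions.
    compare : ∀ {S R} → Tower S → Tower R → S ⊆ᵇ R ⊎ next R ⊆ᵇ S
    compare {R = R} (⋃ᵗ 𝒮 f) u with em {P = ∃[ S ] 𝒮 S ≡ true × next R ⊆ᵇ S}
    ... | yes (S , S∈ , le) = inj₂ λ x∈ → ⟦⟧⁺ (Union 𝒮) (S , S∈ , le x∈)
    ... | no none = inj₁ λ x∈ → case ⟦⟧⁻ (Union 𝒮) x∈ of λ (S , S∈ , x∈S) →
      case compare (f S∈) u of λ
        { (inj₁ S⊆R) → S⊆R x∈S
        ; (inj₂ le)  → contradiction (S , S∈ , λ {x} → le {x}) none }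
    compare (nextᵗ {S} t) u with compare t u
    ... | inj₂ le  = inj₂ (⊆-next S ∘ le)
    ... | inj₁ S⊆R with compare u t
    ...   | inj₂ le  = inj₁ le
    -- Mutual inclusion makes the two subsets equal, so `next R` and `next S` coincide.
    ...   | inj₁ R⊆S with refl ← ⊆ᵇ-antisym {S} S⊆R R⊆S = inj₂ id

    Independent : Subset → Set a
    Independent S = ∀ {x y} → x ∈ᵇ S → y ∈ᵇ S → x ≢ y → x # y

    tower-independent : ∀ {S} → Tower S → Independent S
    tower-independent (nextᵗ {S} t) x∈ y∈ x≢y
      with ⟦⟧⁻ (Next S) x∈ | ⟦⟧⁻ (Next S) y∈
    ... | inj₁ x∈S | inj₁ y∈S = tower-independent t x∈S y∈S x≢y
    ... | inj₁ x∈S | inj₂ y+  = #-sym (proj₂ (Added⇒Extends {S} em y+) x∈S)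
    ... | inj₂ x+  | inj₁ y∈S = proj₂ (Added⇒Extends {S} em x+) y∈S
    ... | inj₂ x+  | inj₂ y+  = contradiction (Added-unique {S} em x+ y+) x≢y
    tower-independent (⋃ᵗ 𝒮 f) x∈ y∈ x≢y
      with ⟦⟧⁻ (Union 𝒮) x∈ | ⟦⟧⁻ (Union 𝒮) y∈
    ... | S , S∈ , x∈S | R , R∈ , y∈R with compare (f S∈) (f R∈)
    ...   | inj₁ S⊆R = tower-independent (f R∈) (S⊆R x∈S) y∈R x≢y
    ...   | inj₂ le  = tower-independent (f S∈) x∈S (le (⊆-next R y∈R)) x≢y

    -- The union `M` of the whole tower is itself a member, hence so is `next M`, which is therefore
    -- contained in `M`. An element extending `M` would contradict this.
    maximal-independent : ∃[ M ] Independent M × (∀ x → ¬ x ∈ᵇ M → ∃[ y ] y ∈ᵇ M × ¬ x # y)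
    maximal-independent = M , tower-independent M-tower , λ x x∉M → dne λ none →
      full (x , x∉M , λ {y} y∈M → dne λ ¬x#y → none (y , y∈M , ¬x#y))
      where
      M : Subset
      M = ⟦ Union ⟦ Tower ⟧ ⟧

      M-tower : Tower M
      M-tower = ⋃ᵗ ⟦ Tower ⟧ (⟦⟧⁻ Tower)

      next⊆M : next M ⊆ᵇ M
      next⊆M x∈ = ⟦⟧⁺ (Union ⟦ Tower ⟧) (next M , ⟦⟧⁺ Tower (nextᵗ M-tower) , x∈)

      full : ¬ ∃ (Extends M)
      full e =
        let _ , x+ = Added-exists em e
        in proj₁ (Added⇒Extends {M} em x+) (next⊆M (⟦⟧⁺ (Next M) (inj₂ x+)))

-- Walks, regions and components.

module _ {ℓ} (G : Graph ℓ) where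
  open Graph G

  module _ {p} {P : Pred V p} where

    start : ∀ {u v} → WalkIn G P u v → P u
    start (ε     , p ∷ _) = p
    start (_ ◅ _ , p ∷ _) = p

    _▷_ : ∀ {u v x} → WalkIn G P u v → WalkIn G P v x → WalkIn G P u x
    (ε     , _     ) ▷ w = w
    (e ◅ u , p ∷ ps) ▷ w = let w′ , qs = (u , ps) ▷ w in e ◅ w′ , p ∷ qs

    edge : ∀ {u v} → P u → u ~ v → P v → WalkIn G P u v
    edge p e q = e ◅ ε , p ∷ q ∷ []

    reverse : ∀ {u v} → WalkIn G P u v → WalkIn G P v u
    reverse (ε     , ps    ) = ε , ps
    reverse (e ◅ w , p ∷ ps) = reverse (w , ps) ▷ edge (start (w , ps)) (~-sym e) p

    end : ∀ {u v} → WalkIn G P u v → P v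
    end w = start (reverse w)

    everyPrefix : ∀ {u v} (w : WalkIn G P u v) →
      All (WalkIn G P u) (vertices G (proj₁ w))
    everyPrefix (ε     , ps    ) = (ε , ps) ∷ []
    everyPrefix (e ◅ w , p ∷ ps) = (ε , p ∷ []) ∷
      All.map (edge p e (start (w , ps)) ▷_) (everyPrefix (w , ps))

  restrict : ∀ {p q} {P : Pred V p} {Q : Pred V q} {u v} (w : WalkIn G P u v) →
    (∀ {x} → x ∈ vertices G (proj₁ w) → P x → Q x) → WalkIn G Q u v
  restrict (w , ps) f = w , All.tabulate λ x∈ → f x∈ (All.lookup ps x∈)

  -- The component of G - X containing the given root, described by reachability; it is empty if the
  -- root lies in `X`.
  Region : List V → V → Pred V ℓ
  Region X = WalkIn G (_∉ X)

  enlarge : ∀ {X Y u v} → (∀ {x} → x ∈ X → x ∈ Y) → Region Y u v → Region X u v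
  enlarge X⊆Y w = restrict w λ _ x∉Y → x∉Y ∘ X⊆Y

  region-isComponent : ∀ {X v} → v ∉ X → IsComponent G X (Region X v)
  region-isComponent {X} {v} v∉X = record
    { avoids    = end
    ; connected = (v , ε , v∉X ∷ []) , λ v⇝x v⇝y →
        let x⇝y = reverse v⇝x ▷ v⇝y
        in proj₁ x⇝y , All.map (v⇝x ▷_) (everyPrefix x⇝y)
    ; maximal   = λ D D∩X conn region⊆D d →
        restrict (proj₂ conn (region⊆D (ε , v∉X ∷ [])) d) λ _ → D∩X
    }

  module _ {X C} (comp : IsComponent G X C) where
    open IsComponent comp

    component⊆region : ∀ {u v} → C u → C v → Region X u v
    component⊆region u∈C v∈C = restrict (proj₂ connected u∈C v∈C) λ _ → avoids

    region⊆component : ∀ {u v} → C u → Region X u v → C v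
    region⊆component {u} u∈C = maximal (Region X u)
      (IsComponent.avoids region) (IsComponent.connected region) (component⊆region u∈C)
      where region = region-isComponent (avoids u∈C)

  -- Tails of rays and the topology on the ends.

  open Ray

  shift : ℕ → Ray G → Ray G
  shift m R = record
    { at        = at R ∘ (m +_)
    ; adjacent  = λ n →
        subst (λ k → at R (m + n) ~ at R k) (sym (+-suc m n)) (adjacent R (m + n))
    ; injective = λ eq → +-cancelˡ-≡ m _ _ (injective R eq)
    }

  HasRay : List V → V → Set ℓ
  HasRay X v = Σ[ R ∈ Ray G ] (∀ i → Region X v (at R i))

  Tail : Ray G → List V → ℕ → Set ℓ
  Tail R X m = ∀ {k} → m ≤ k → at R k ∉ X

  tail-region : ∀ R {X m} → Tail R X m → ∀ {k} → m ≤ k → Region X (at R m) (at R k)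
  tail-region R avoid {zero} z≤n = ε , avoid z≤n ∷ []
  tail-region R avoid {suc k} m≤ with m≤n⇒m<n∨m≡n m≤
  ... | inj₁ m<  = tail-region R avoid (s≤s⁻¹ m<) ▷
                   edge (avoid (s≤s⁻¹ m<)) (adjacent R k) (avoid m≤)
  ... | inj₂ refl = ε , avoid ≤-refl ∷ []

  tail-mono : ∀ R {X m n} → m ≤ n → Tail R X m → Tail R X n
  tail-mono R m≤n avoid n≤k = avoid (≤-trans m≤n n≤k)

  module Space (em : ∀ {a} → ExcludedMiddle a) where
    open Classical em

    tail-avoids : ∀ R X → ∃[ m ] Tail R X m
    tail-avoids R [] = 0 , λ _ ()
    tail-avoids R (x ∷ X) with tail-avoids R X | em {P = OnRay G R x}
    ... | m , avoid | no x∉R = m , λ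
      { m≤k (here eq)  → x∉R (_ , eq)
      ; m≤k (there k∈) → avoid m≤k k∈ }
    ... | m , avoid | yes (n , refl) = m ⊔ suc n , λ
      { mn≤k (here eq)  → <-irrefl (sym (injective R eq)) (≤-trans (m≤n⊔m m (suc n)) mn≤k)
      ; mn≤k (there k∈) → avoid (≤-trans (m≤m⊔n m (suc n)) mn≤k) k∈ }

    hasRay : ∀ R {X m} → Tail R X m → HasRay X (at R m)
    hasRay R {m = m} avoid = shift m R , λ i → tail-region R avoid (m≤m+n m i)

    -- Equivalence applied to X together with initial segments of both rays
    -- links their tails.
    ≈⇒linked : ∀ {R S X} m n → _≈_ G R S →
      ∃[ i ] ∃[ j ] m ≤ i × n ≤ j × Region X (at R i) (at S j)
    ≈⇒linked {R} {S} {X} m n R≈S = dne λ none → R≈S Y λ {i} {j} w →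
      none (i , j , ≮⇒≥ (λ i<m → start w (∈-++⁺ˡ (∈-applyUpTo⁺ (at R) i<m)))
                  , ≮⇒≥ (λ j<n → end w (∈-++⁺ʳ Rm (∈-++⁺ˡ (∈-applyUpTo⁺ (at S) j<n))))
                  , enlarge (∈-++⁺ʳ Rm ∘ ∈-++⁺ʳ (applyUpTo (at S) n)) w)
      where
      Rm = applyUpTo (at R) m
      Y  = Rm ++ applyUpTo (at S) n ++ X

    -- A link to an equivalent ray is taken beyond the indices from which both rays avoid `X`, so a
    -- tail of that ray is on the same side of `X`.
    tail⇒Ω : ∀ S {X v m} → Tail S X m → Region X v (at S m) → Ω G (Region X v) S
    tail⇒Ω S {X} {v} {n} S∩X v⇝S {R} R≈S =
      let m , R∩X = tail-avoids R X
          i , j , m≤i , n≤j , w = ≈⇒linked {R} {S} {X} m n R≈S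
      in i , λ i≤k → v⇝S ▷ (tail-region S S∩X n≤j ▷
           (reverse w ▷ tail-region R (tail-mono R m≤i R∩X) i≤k))

    Ω⇒tail : ∀ {C S} → Ω G C S → HasTailIn G C S
    Ω⇒tail {S = S} S∈ = S∈ {S} (≈-refl G {S})

    Ω-mono : ∀ {C D : Pred V ℓ} {S} → (∀ {v} → C v → D v) → Ω G C S → Ω G D S
    Ω-mono C⊆D S∈ {R} R≈S = let m , tail = S∈ {R} R≈S in m , C⊆D ∘ tail

    Ω-region-open : ∀ X v → Open G (Ω G (Region X v))
    Ω-region-open X v {S} S∈ =
      let m , tail = Ω⇒tail {Region X v} {S} (λ {R} → S∈ {R})
      in X , Region X v , region-isComponent (start {P = _∉ X} (tail ≤-refl)) , (λ {R} → S∈ {R}) , id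

    infinite-part : ∀ R (P : Pred V ℓ) → ¬ Finite (λ v → OnRay G R v × P v) →
      ∀ m → ∃[ k ] m ≤ k × P (at R k)
    infinite-part R P inf m = dne λ none → inf (applyUpTo (at R) m , λ
      { ((k , refl) , p) → ∈-applyUpTo⁺ (at R)
          (≰⇒> λ m≤k → none (k , m≤k , p)) })

    -- From a star-decomposition to disjoint open sets.

    disjointOpens⇒¬secondCountable : UncountablyManyDisjointOpens G → ¬ SecondCountable G
    disjointOpens⇒¬secondCountable (K , K-unc , U , U-open , U-sat , U-disj) (I , I-cnt , B , _ , B-base) =
      -- If `k` and `l` received the same basic set, it would contain `point k` and lie in both
      -- `U k` and `U l`.
      K-unc (mk↣ {to = λ k → Injection.to I-cnt (basic k)} λ {k} {l} eq → dne λ k≢l →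
        U-disj k≢l (point k)
          ( basic⊆ k (∋point k)
          , basic⊆ l (subst (λ i → B i (point k)) (Injection.injective I-cnt eq) (∋point k))))
      where
      point : K → End G
      point k = proj₁ (U-sat k)

      choice : ∀ k → ∃[ i ] B i (point k) × (∀ {ω} → B i ω → U k ω)
      choice k = B-base (U k) (U-open k) (proj₂ (U-sat k))

      basic  = λ k → proj₁ (choice k)
      ∋point = λ k → proj₁ (proj₂ (choice k))

      basic⊆ : ∀ k {ω} → B (basic k) ω → U k ω
      basic⊆ k = proj₂ (proj₂ (choice k))

    -- Each leaf contributes the ends of the component, outside its adhesion set, in which a ray of
    -- its end finally runs. This component stays in the leaf part, and vertices shared by two leaf
    -- parts lie in the adhesion sets.
    star⇒disjointOpens : HasUncountableStarDecomposition G → UncountablyManyDisjointOpens G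
    star⇒disjointOpens (K , K-unc , D , finite , ends) =
      K , K-unc , U , (λ k {ω} → Ω-region-open (adhesion k) (base k) {ω})
        , (λ k → ray k , λ {R} →
            tail⇒Ω (ray k) (avoid k) (ε , avoid k ≤-refl ∷ []) {R})
        , disjoint
      where
      open TreeDecomposition D

      leaves∩⊆centre : ∀ {k l v} → k ≢ l → part (just k) v → part (just l) v → part nothing v
      leaves∩⊆centre k≢l v∈k v∈l = between (inn ◅ out ◅ ε)
        (((λ ()) ∷ (λ { refl → k≢l refl }) ∷ []) ∷ ((λ ()) ∷ []) ∷ [] ∷ [])
        (there (here refl)) (v∈k , v∈l)

      adhesion : K → List V
      adhesion k = proj₁ (finite (out {k = k}))

      ray : K → Ray G
      ray k = proj₁ (proj₂ (ends k))

      entry : ∀ k → ∃[ n ] Tail (ray k) (adhesion k) n × part (just k) (at (ray k) n)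
      entry k =
        let _ , R , _ , inf = ends k
            m , R∩X         = tail-avoids R (adhesion k)
            n , m≤n , Rn∈   = infinite-part R (part (just k)) inf m
        in n , tail-mono R m≤n R∩X , Rn∈

      base : K → V
      base k = at (ray k) (proj₁ (entry k))

      avoid : ∀ k → Tail (ray k) (adhesion k) (proj₁ (entry k))
      avoid k = proj₁ (proj₂ (entry k))

      -- The edge leaving `v` lies in some part. Neither the centre nor another leaf is possible, as
      -- either would put `v` into the adhesion set.
      stays : ∀ {k v w} → part (just k) v → Region (adhesion k) v w → part (just k) w
      stays v∈k (ε , _) = v∈k
      stays {k} {v} v∈k (_◅_ {j = x} e w , v∉X ∷ ps) = stays x∈k (w , ps)
        where
        v∉centre : ¬ part nothing v
        v∉centre v∈ = v∉X (proj₂ (finite (out {k = k})) (v∈ , v∈k))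

        x∈k : part (just k) x
        x∈k with coversEdges e
        ... | nothing , v∈ , _  = contradiction v∈ v∉centre
        ... | just l , v∈l , x∈l with em {P = k ≡ l}
        ...   | yes refl = x∈l
        ...   | no k≢l   = contradiction (leaves∩⊆centre k≢l v∈k v∈l) v∉centre

      C : K → Pred V ℓ
      C k = Region (adhesion k) (base k)

      C⊆part : ∀ k {v} → C k v → part (just k) v
      C⊆part k = stays (proj₂ (proj₂ (entry k)))

      C-disjoint : ∀ {k l v} → k ≢ l → C k v → C l v → ⊥
      C-disjoint {k} {l} k≢l v∈k v∈l = end v∈k (proj₂ (finite (out {k = k}))
        (leaves∩⊆centre k≢l (C⊆part k v∈k) (C⊆part l v∈l) , C⊆part k v∈k))

      U : K → Pred (End G) ℓ
      U k = Ω G (C k)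

      disjoint : ∀ {k l} → k ≢ l → ∀ ω → ¬ (U k ω × U l ω)
      disjoint {k} {l} k≢l ω (ω∈k , ω∈l) =
        let m , inₖ = Ω⇒tail {C k} {ω} (λ {R} → ω∈k {R})
            n , inₗ = Ω⇒tail {C l} {ω} (λ {R} → ω∈l {R})
        in C-disjoint k≢l (inₖ (m≤m⊔n m n)) (inₗ (m≤n⊔m m n))

    -- From non-adjacent regions to a star-decomposition.

    Apart : Rel (Pred V ℓ) ℓ
    Apart C D = ∀ {u v} → C u → D v → u ≢ v × ¬ u ~ v

    -- A leaf part is a region together with its neighbours; the centre consists of the vertices in
    -- no region. Non-adjacency puts the neighbours into the centre, and they lie in `X k`, so
    -- adhesion is finite.
    apart⇒star : (K : Set ℓ) → Uncountable K → (X : K → List V) (v : K → V) →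
      (∀ k → HasRay (X k) (v k)) →
      (∀ {k l} → k ≢ l → Apart (Region (X k) (v k)) (Region (X l) (v l))) →
      HasUncountableStarDecomposition G
    apart⇒star K K-unc X v rays apart = K , K-unc , D , finite , lives
      where
      C : K → Pred V ℓ
      C k = Region (X k) (v k)

      part : Maybe K → Pred V ℓ
      part nothing  u = ∀ k → ¬ C k u
      part (just k) u = C k u ⊎ (¬ C k u × ∃[ w ] C k w × u ~ w)

      C-unique : ∀ {k l u} → C k u → C l u → k ≡ l
      C-unique u∈k u∈l = dne λ k≢l → proj₁ (apart k≢l u∈k u∈l) refl

      C-nonadjacent : ∀ {k l u w} → C k u → C l w → u ~ w → k ≡ l
      C-nonadjacent u∈k w∈l e = dne λ k≢l → proj₂ (apart k≢l u∈k w∈l) e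

      leaves∩⊆centre : ∀ {k l u} → k ≢ l → part (just k) u → part (just l) u → part nothing u
      leaves∩⊆centre k≢l (inj₁ u∈k) (inj₁ u∈l) = contradiction (C-unique u∈k u∈l) k≢l
      leaves∩⊆centre k≢l (inj₁ u∈k) (inj₂ (_ , w , w∈l , e)) =
        contradiction (C-nonadjacent u∈k w∈l e) k≢l
      leaves∩⊆centre k≢l (inj₂ (_ , w , w∈k , e)) (inj₁ u∈l) =
        contradiction (sym (C-nonadjacent u∈l w∈k e)) k≢l
      leaves∩⊆centre k≢l (inj₂ (u∉k , w , w∈k , e)) (inj₂ _) m u∈m
        with refl ← C-nonadjacent u∈m w∈k e = u∉k u∈m

      D : TreeDecomposition G (K₁, K)
      D = record
        { part        = part
        ; covers      = λ u → case em {P = ∃[ k ] C k u} of λ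
            { (yes (k , u∈k)) → just k , inj₁ u∈k
            ; (no none)       → nothing , λ k u∈k → none (k , u∈k) }
        ; coversEdges = edges
        ; between     = between
        }
        where
        edges : ∀ {u w} → u ~ w → ∃[ t ] part t u × part t w
        edges {u} {w} e with em {P = ∃[ k ] C k u} | em {P = ∃[ k ] C k w}
        ... | yes (k , u∈k) | yes (l , w∈l) with refl ← C-nonadjacent u∈k w∈l e =
          just k , inj₁ u∈k , inj₁ w∈l
        ... | yes (k , u∈k) | no none =
          just k , inj₁ u∈k , inj₂ ((λ w∈k → none (k , w∈k)) , u , u∈k , ~-sym e)
        ... | no none | yes (l , w∈l) =
          just l , inj₂ ((λ u∈l → none (l , u∈l)) , w , w∈l , e) , inj₁ w∈l
        ... | no none | no none′ =
          nothing , (λ k u∈k → none (k , u∈k)) , λ k w∈k → none′ (k , w∈k)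

        between : ∀ {t₁ t₂ t₃} (p : Walk (Tree.graph (K₁, K)) t₁ t₃) →
          IsPath (Tree.graph (K₁, K)) p → t₂ ∈ vertices (Tree.graph (K₁, K)) p →
          ∀ {u} → part t₁ u × part t₃ u → part t₂ u
        between ε             _ (here refl)                 (u₁ , _)  = u₁
        between (_ ◅ _)       _ (here refl)                 (u₁ , _)  = u₁
        between (_ ◅ ε)       _ (there (here refl))         (_  , u₃) = u₃
        between (out ◅ inn ◅ ε)     ((_ ∷ ≢ ∷ _) ∷ _) _ _ = contradiction refl ≢
        between (out ◅ inn ◅ _ ◅ _) ((_ ∷ ≢ ∷ _) ∷ _) _ _ = contradiction refl ≢
        between (inn ◅ out ◅ ε) ((_ ∷ k≢l ∷ _) ∷ _) (there (here refl)) (u₁ , u₃) =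
          leaves∩⊆centre (k≢l ∘ cong just) u₁ u₃
        between (inn ◅ out ◅ ε) _ (there (there (here refl))) (_ , u₃) = u₃
        between (inn ◅ out ◅ inn ◅ ε)     (_ ∷ (_ ∷ ≢ ∷ _) ∷ _) _ _ = contradiction refl ≢
        between (inn ◅ out ◅ inn ◅ _ ◅ _) (_ ∷ (_ ∷ ≢ ∷ _) ∷ _) _ _ = contradiction refl ≢

      open TreeDecomposition D using (FiniteAdhesion)

      N⊆X : ∀ {k u} → part (just k) u → part nothing u → u ∈ X k
      N⊆X {k} (inj₁ u∈k) u∉ = contradiction u∈k (u∉ k)
      N⊆X {k} (inj₂ (_ , w , w∈k , e)) u∉ = dne λ u∉X →
        u∉ k (w∈k ▷ edge (end w∈k) (~-sym e) u∉X)

      finite : FiniteAdhesion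
      finite (out {k}) = X k , λ (u∉ , u∈) → N⊆X u∈ u∉
      finite (inn {k}) = X k , λ (u∈ , u∉) → N⊆X u∈ u∉

      lives : ∀ k → ∃[ ω ] LivesIn G ω (part (just k))
      lives k =
        let R , R∈ = rays k
        in R , R , ≈-refl G {R} , λ (xs , R∩⊆xs) →
          let m , avoid = tail-avoids R xs
          in avoid ≤-refl (R∩⊆xs ((m , refl) , inj₁ (R∈ m)))

    -- A countable base from a dense set.

    Dense : (ℕ → V) → Set ℓ
    Dense s = ∀ {X v} → HasRay X v → ∃[ i ] Region X v (s i)

    -- With `X` restricted to finite subsets of `s` there are only countably many requirements, so
    -- some countable set meets them all.
    PathClosed : (ℕ → V) → Set ℓ
    PathClosed s = ∀ {X u v} → All (_∈ˢ s) X → u ∈ˢ s → v ∈ˢ s →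
      Region X u v → WalkIn G (λ x → x ∈ˢ s × x ∉ X) u v

    -- For X₀ = X ∩ s, no region of G − X₀ has vertices of s on different sides of X,
    -- because s is path-closed; as s is dense, all ends of the region lie on the
    -- same side of X.
    dense⇒secondCountable : ∀ {s} → Dense s → PathClosed s → SecondCountable G
    dense⇒secondCountable {s} dense closed = ℕ , mk↣ {to = id} id , B , B-open , B-base
      where
      B : ℕ → Pred (End G) ℓ
      B n = let a , i = unpair n in Ω G (Region (lists s a) (s i))

      B-open : ∀ n → Open G (B n)
      B-open n {ω} = Ω-region-open (lists s (proj₁ (unpair n))) (s (proj₂ (unpair n))) {ω}

      B-surjective : ∀ {X} i → All (_∈ˢ s) X → ∃[ n ] B n ≡ Ω G (Region X (s i))
      B-surjective i X∈ =
        let a , la≡ = ∈-lists s X∈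
            n , un≡ = unpair-surjective a i
        in n , trans (cong (λ (a , i) → Ω G (Region (lists s a) (s i))) un≡)
                     (cong (λ X → Ω G (Region X (s i))) la≡)

      B-base : ∀ U → Open G U → ∀ {ω} → U ω → ∃[ n ] B n ω × (∀ {η} → B n η → U η)
      B-base U U-open {ω} ω∈U
        with X , C , comp , ω∈C , ΩC⊆U ← U-open ω∈U
        with m , tail ← Ω⇒tail {C} {ω} (λ {R} → ω∈C {R})
        -- The component `C` contains a tail of `ω`, so density yields a vertex `s i` of `C`; it
        -- becomes the root of the basic set.
        with i , v⇝u ← dense {X} {at ω m} (shift m ω , λ k →
          component⊆region comp (tail ≤-refl) (tail (m≤m+n m k)))
        = let n , Bn≡ = B-surjective i X₀∈
          in n , (λ {S} → subst (λ P → P ω) (sym Bn≡) (λ {R} → ω∈B {R}) {S})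
               , λ {η} η∈ → ΩC⊆U {η} (λ {R} → B⊆C {η}
                   (λ {S} → subst (λ P → P η) Bn≡ (λ {T} → η∈ {T}) {S}) {R})
        where
        ∈s? = λ x → em {P = x ∈ˢ s}

        X₀ : List V
        X₀ = filter ∈s? X

        X₀⊆X : ∀ {x} → x ∈ X₀ → x ∈ X
        X₀⊆X = proj₁ ∘ ∈-filter⁻ ∈s? {xs = X}

        X₀∈ : All (_∈ˢ s) X₀
        X₀∈ = All.tabulate (proj₂ ∘ ∈-filter⁻ ∈s? {xs = X})

        ω∈B : Ω G (Region X₀ (s i)) ω
        ω∈B {R} = tail⇒Ω ω (λ m≤k → IsComponent.avoids comp (tail m≤k) ∘ X₀⊆X)
          (reverse (enlarge X₀⊆X v⇝u)) {R}

        -- Path-closure gives a walk within `s` outside `X₀`; since `X₀` is all of `X ∩ s`, this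
        -- walk avoids `X`.
        undivided : ∀ {j} → Region X₀ (s i) (s j) → Region X (s i) (s j)
        undivided w = restrict (closed X₀∈ (_ , refl) (_ , refl) w)
          λ _ (x∈s , x∉X₀) x∈X → x∉X₀ (∈-filter⁺ ∈s? x∈X x∈s)

        -- Density finds some `s j` on the side of `X` where a tail of `η` runs, and `undivided`
        -- joins it to `s i` outside `X`.
        B⊆C : ∀ {η} → Ω G (Region X₀ (s i)) η → Ω G C η
        B⊆C {η} η∈ {R} =
          let m₁ , tail₁ = Ω⇒tail {Region X₀ (s i)} {η} (λ {R} → η∈ {R})
              m₂ , η∩X   = tail-avoids η X
              η∩X′       = tail-mono η (m≤n⊔m m₁ m₂) η∩X
              j , ηk⇝sj  = dense (hasRay η η∩X′)
              si⇝sj      = undivided (tail₁ (m≤m⊔n m₁ m₂) ▷ enlarge X₀⊆X ηk⇝sj)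
          in Ω-mono {Region X (at ω m)} {C} {η} (region⊆component comp (tail ≤-refl))
               (λ {R} → tail⇒Ω η η∩X′ (v⇝u ▷ (si⇝sj ▷ reverse ηk⇝sj)) {R}) {R}

    -- Each stage adds one walk, where it exists, for every finite list and every two vertices of
    -- the stage before. The data of a requirement are finite, so they all lie in one stage and the
    -- next one satisfies it.
    pathClosure : ∀ s → ∃[ t ] s ⊆ˢ t × PathClosed t
    pathClosure s = ⋃ˢ stage , ⊆-⋃ˢ stage 0 , closed
      where
      inner : ∀ {X u v} → Dec (Region X u v) → List V
      inner (yes (w , _)) = vertices G w
      inner (no _)        = []

      -- The given walk may differ from the one whose vertices were added; it is replaced by the one
      -- stored in the decision.
      inner-walk : ∀ {X u v} (d : Dec (Region X u v)) → Region X u v →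
        Σ[ w ∈ Region X u v ] vertices G (proj₁ w) ≡ inner d
      inner-walk (yes w) _ = w , refl
      inner-walk (no ¬w) w = contradiction w ¬w

      links : (ℕ → V) → ℕ → ℕ → ℕ → List V
      links t a i j = inner (em {P = Region (lists t a) (t i) (t j)})

      linksAt : (ℕ → V) → ℕ → List V
      linksAt t n = let a , m = unpair n ; i , j = unpair m in links t a i j

      stage : ℕ → ℕ → V
      stage zero    = s
      stage (suc k) = adjoin (mk↣ {to = id} id) (linksAt (stage k)) (stage k)

      stage-inc : ∀ k → stage k ⊆ˢ stage (suc k)
      stage-inc k = ⊆-adjoin _ (linksAt (stage k)) (stage k)

      links⊆ : ∀ k a i j {x} → x ∈ links (stage k) a i j → x ∈ˢ stage (suc k)
      links⊆ k a i j {x} x∈ =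
        let m , um≡ = unpair-surjective i j
            n , un≡ = unpair-surjective a m
        in ∈-adjoin _ (linksAt (stage k)) (stage k) n
             (subst (λ (a , m) → x ∈ links (stage k) a (proj₁ (unpair m)) (proj₂ (unpair m))) (sym un≡)
               (subst (λ (i , j) → x ∈ links (stage k) a i j) (sym um≡) x∈))

      closed : PathClosed (⋃ˢ stage)
      closed X∈ u∈ v∈ w with All-stage stage stage-inc (u∈ ∷ v∈ ∷ X∈)
      ... | k , (i , refl) ∷ (j , refl) ∷ X∈k with ∈-lists (stage k) X∈k
      ...   | a , refl =
        let w′ , eq = inner-walk em w
        in restrict w′ λ x∈ x∉X →
             ⊆-⋃ˢ stage (suc k) (links⊆ k a i j (subst (_ ∈_) eq x∈)) , x∉X

    -- Construction of a dense set.

    Meets : ℕ → (ℕ → V) → Set ℓ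
    Meets n s = ∀ {X v} → length X < n → HasRay X v → ∃[ i ] Region X v (s i)

    reach : ∀ {s t : ℕ → V} {X v} → s ⊆ˢ t → ∃[ i ] Region X v (s i) → ∃[ i ] Region X v (t i)
    reach {X = X} {v} s⊆t (i , w) =
      let j , eq = s⊆t (i , refl) in j , subst (Region X v) (sym eq) w

    Dense-mono : ∀ {s t} → s ⊆ˢ t → Dense s → Dense t
    Dense-mono s⊆t dense rays = reach s⊆t (dense rays)

    ⋃-dense : ∀ s → (∀ n → Meets n (s n)) → Dense (⋃ˢ s)
    ⋃-dense s meets rays = reach (⊆-⋃ˢ s _) (meets _ ≤-refl rays)

    -- A set P contained in infinitely many Y k can be enlarged as long as
    -- it has fewer than n elements: the component of G − P containing R meets
    -- s by minimality of n, and a walk witnessing this meets every Y k outside P.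
    -- In the end Y k = P for infinitely many k, contradicting fresh.
    module _ {n s} (meets : Meets n s) (Y : ℕ → List V) (w : ℕ → V) (d : V) (R : Ray G)
      (short  : ∀ k → length (Y k) ≤ n)
      (inside : ∀ k → Region (Y k) d (w k))
      (ray    : ∀ k i → Region (Y k) d (at R i))
      (avoids : ∀ k i → ¬ Region (Y k) d (s i))
      (fresh  : ∀ {k l} → k < l → ¬ Region (Y l) d (w k)) where

      private
        -- Invariant of the descent: `P` is the common part found so far, and the budget `m` for the
        -- other elements of `Y k` drops whenever `P` grows.
        Rest : List V → (ℕ → List V) → ℕ → Pred ℕ ℓ
        Rest P Z m k = (∀ {x} → x ∈ P → x ∈ Y k) × (∀ {x} → x ∈ Y k → x ∈ P ⊎ x ∈ Z k) ×
          length (Z k) ≤ m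

        without : V → List V → List V
        without p = filter (λ x → ¬? (em {P = p ≡ x}))

        grow : ∀ m P Z → length P + m ≤ n → ¬ Infinite (Rest P Z m)
        grow zero P Z _ inf =
          -- The budget is spent, so `Y l ⊆ P ⊆ Y k`, and the walk to `w k` outside `Y k` also
          -- avoids `Y l`.
          let k , _ , P⊆Yk , _ = inf 0
              l , k<l , _ , Yl⊆ , Zl≤ = inf (suc k)
          in fresh k<l (enlarge (λ x∈ → P⊆Yk ([ id , ⊥-elim ∘ empty Zl≤ ]′ (Yl⊆ x∈))) (inside k))
          where
          empty : ∀ {xs : List V} {x} → length xs ≤ 0 → x ∉ xs
          empty () (here _)
          empty () (there _)
        grow (suc m) P Z P+m≤n inf =
          let k₀ , _ , P⊆Y , _ = inf 0
              i , c = meets {P} {d} (≤-trans (s≤s (m≤m+n (length P) m)) P+m<n)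
                        (R , λ i → enlarge P⊆Y (ray k₀ i))
              -- The walk `c` is fixed before `k` varies, so one of its finitely many vertices
              -- serves infinitely many `k`.
              p , infₚ = pigeonhole {S = λ k x → Rest P Z (suc m) k × x ∈ Y k × x ∈ Z k}
                (vertices G (proj₁ c)) λ l →
                let k , l≤k , rest = inf l in k , l≤k , crossing c rest
          in grow m (p ∷ P) (without p ∘ Z)
               P+m<n
               λ l → let k , l≤k , rest , p∈Y , p∈Z = infₚ l in k , l≤k , refine p rest p∈Y p∈Z
          where
          P+m<n : length P + m < n
          P+m<n = subst (_≤ n) (+-suc (length P) m) P+m≤n

          crossing : ∀ {i k} (c : Region P d (s i)) → Rest P Z (suc m) k →
            ∃[ x ] x ∈ vertices G (proj₁ c) × Rest P Z (suc m) k × x ∈ Y k × x ∈ Z k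
          crossing {i} {k} c rest@(_ , Y⊆ , _) = dne λ none → avoids k i
            (restrict c λ x∈ x∉P x∈Y → none (_ , x∈ , rest , x∈Y ,
              [ (λ x∈P → contradiction x∈P x∉P) , id ]′ (Y⊆ x∈Y)))

          refine : ∀ p {k} → Rest P Z (suc m) k → p ∈ Y k → p ∈ Z k →
            Rest (p ∷ P) (without p ∘ Z) m k
          refine p {k} (P⊆ , Y⊆ , Z≤) p∈Y p∈Z =
            (λ { (here refl) → p∈Y ; (there x∈) → P⊆ x∈ })
            , split
            , s≤s⁻¹ (≤-trans (filter-notAll _ (Z k) (Any.map (λ eq ¬eq → ¬eq eq) p∈Z)) Z≤)
            where
            split : ∀ {x} → x ∈ Y k → x ∈ p ∷ P ⊎ x ∈ without p (Z k)
            split {x} x∈ with em {P = p ≡ x} | Y⊆ x∈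
            ... | yes p≡x | _        = inj₁ (here (sym p≡x))
            ... | no _    | inj₁ x∈P = inj₁ (there x∈P)
            ... | no p≢x  | inj₂ x∈Z = inj₂ (∈-filter⁺ (λ x → ¬? (em {P = p ≡ x})) x∈Z p≢x)

      no-descent : ⊥
      no-descent = grow n [] Y ≤-refl λ l → l , ≤-refl , (λ ()) , inj₂ , short l

    record RayRegion (n : ℕ) (s : ℕ → V) : Set ℓ where
      field
        boundary : List V
        root     : V
        short    : length boundary ≤ n
        rays     : HasRay boundary root
        avoids   : ∀ i → ¬ Region boundary root (s i)

      region : Pred V ℓ
      region = Region boundary root

    module _ (ext : ∀ {a b} → Extensionality a b) (no-star : ¬ HasUncountableStarDecomposition G) where

      -- By maximality, a region avoiding t touches a member of the maximal family;
      -- as it avoids the boundary of this member, it is contained in it.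
      absorb : ∀ n s → ∃[ t ] s ⊆ˢ t × (∀ {X v} → length X ≤ n → HasRay X v →
        (∀ i → ¬ Region X v (t i)) →
        Σ[ D ∈ RayRegion n s ] RayRegion.root D ∈ˢ t ×
          (∀ {x} → Region X v x → RayRegion.region D x))
      absorb n s with Classical.Maximal.maximal-independent em ext {A = RayRegion n s}
        (λ D E → Apart (RayRegion.region D) (RayRegion.region E))
        (λ apart u∈ v∈ → let v≢u , v≁u = apart v∈ u∈ in v≢u ∘ sym , v≁u ∘ ~-sym)
      ... | M , independent , maximal = adjoin count core s , ⊆-adjoin count core s , contain
        where
        open RayRegion

        K : Set ℓ
        K = Σ[ D ∈ RayRegion n s ] M D ≡ true

        core : K → List V
        core (D , _) = root D ∷ boundary D

        count : K ↣ ℕ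
        count = dne λ K-unc → no-star (apart⇒star K K-unc (boundary ∘ proj₁) (root ∘ proj₁)
          (rays ∘ proj₁) λ { {D , D∈} {E , E∈} ≢ → independent D∈ E∈
            -- Distinct indices have distinct regions, because proofs of `M D ≡ true` are unique.
            λ { refl → ≢ (cong (D ,_) (uip D∈ E∈)) } })

        t : ℕ → V
        t = adjoin count core s

        t-core : ∀ {D} → M D ≡ true → ∀ {x} → x ∈ root D ∷ boundary D → x ∈ˢ t
        t-core {D} D∈ = ∈-adjoin count core s (D , D∈)

        contain : ∀ {X v} → length X ≤ n → HasRay X v → (∀ i → ¬ Region X v (t i)) →
          Σ[ D ∈ RayRegion n s ] root D ∈ˢ t × (∀ {x} → Region X v x → region D x)
        contain {X} {v} X≤n v-rays X∩t =
          let E , E∈ , ¬apart = maximal D D∉M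
          -- If `x` were outside the region of `E`, the two regions would be apart: a common vertex,
          -- or an edge from `y` into that region, would let a walk avoiding the boundary of `E`
          -- bring `x` into it.
          in E , t-core E∈ (here refl) , λ v⇝x → dne λ x∉E → ¬apart λ {y} {z} v⇝y z∈E →
               (λ { refl → x∉E (into E∈ z∈E v⇝y v⇝x) })
             , λ y~z → x∉E (into E∈
                 (z∈E ▷ edge (end z∈E) (~-sym y~z) (avoidsBoundary E∈ v⇝y)) v⇝y v⇝x)
          where
          D : RayRegion n s
          D = record
            { boundary = X ; root = v ; short = X≤n ; rays = v-rays
            ; avoids = λ i w → let j , w′ = reach (⊆-adjoin count core s) (i , w) in X∩t j w′ }

          X∌v : v ∉ X
          X∌v = start (proj₂ v-rays 0)

          -- The roots of the members of `M` were added to `t`, whereas the region of `D` avoids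
          -- `t`.
          D∉M : ¬ M D ≡ true
          D∉M D∈ = let i , ti≡v = t-core D∈ (here refl)
                   in X∩t i (subst (Region X v) (sym ti≡v) (ε , X∌v ∷ []))

          avoidsBoundary : ∀ {E} → M E ≡ true → ∀ {y} → Region X v y → y ∉ boundary E
          avoidsBoundary E∈ v⇝y y∈ =
            let i , ti≡y = t-core E∈ (there y∈)
            in X∩t i (subst (Region X v) (sym ti≡y) v⇝y)

          into : ∀ {E} → M E ≡ true → ∀ {y x} →
            region E y → Region X v y → Region X v x → region E x
          into E∈ y∈E v⇝y v⇝x = y∈E ▷ restrict
            (proj₂ (IsComponent.connected (region-isComponent X∌v)) v⇝y v⇝x)
            λ _ → avoidsBoundary E∈

      meetsNext : ∀ n s → Meets n s → ∃[ t ] Meets (suc n) t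
      meetsNext n s meets = ⋃ˢ stage , λ X<n rays → dne (unavoidable X<n rays)
        where
        open RayRegion

        stage : ℕ → ℕ → V
        stage zero    = s
        stage (suc k) = proj₁ (absorb n (stage k))

        stage-inc : ∀ k → stage k ⊆ˢ stage (suc k)
        stage-inc k = proj₁ (proj₂ (absorb n (stage k)))

        avoid : ∀ {t} (D : RayRegion n t) {x} → x ∈ˢ t → ¬ region D x
        avoid D (i , refl) = avoids D i

        unavoidable : ∀ {X v} → length X < suc n → HasRay X v →
          ¬ ¬ (∃[ i ] Region X v (⋃ˢ stage i))
        unavoidable {X} {v} X<n (R , R∈) none = no-descent meets
          (boundary ∘ D) (root ∘ D) v R
          (short ∘ D)
          -- All regions `D k` contain `v`, which serves as their common root in the descent.
          (reverse ∘ v∈D)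
          (λ k i → reverse (v∈D k) ▷ ⊆D k (R∈ i))
          (λ k i w → avoid (D k) (stage-mono stage stage-inc {0} {k} z≤n (i , refl)) (v∈D k ▷ w))
          -- For `k < l` the root of `D k` already belongs to stage `l`, which `D l` avoids.
          (λ {k} {l} k<l w →
            avoid (D l) (stage-mono stage stage-inc k<l (root∈ k)) (v∈D l ▷ w))
          where
          above : ∀ k → Σ[ D ∈ RayRegion n (stage k) ] root D ∈ˢ stage (suc k) ×
            (∀ {x} → Region X v x → region D x)
          above k = proj₂ (proj₂ (absorb n (stage k))) (s≤s⁻¹ X<n) (R , R∈) λ i w →
            none (reach (⊆-⋃ˢ stage (suc k)) (i , w))

          D : ∀ k → RayRegion n (stage k)
          D k = proj₁ (above k)

          root∈ : ∀ k → root (D k) ∈ˢ stage (suc k)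
          root∈ k = proj₁ (proj₂ (above k))

          ⊆D : ∀ k {x} → Region X v x → region (D k) x
          ⊆D k = proj₂ (proj₂ (above k))

          v∈D : ∀ k → region (D k) v
          v∈D k = ⊆D k (ε , start (R∈ 0) ∷ [])

      meeting : V → ∀ n → ∃ (Meets n)
      meeting v zero    = (λ _ → v) , λ ()
      meeting v (suc n) = let s , meets = meeting v n in meetsNext n s meets

      -- Density passes to larger sets, so the closure under walks can be taken last.
      secondCountable : V → SecondCountable G
      secondCountable v =
        let s , s⊆ , closed = pathClosure (⋃ˢ (proj₁ ∘ meeting v))
        in dense⇒secondCountable
             (Dense-mono s⊆ (⋃-dense (proj₁ ∘ meeting v) (proj₂ ∘ meeting v))) closed

theorem4p4 : (∀ {a} → ExcludedMiddle a) → (∀ {a b} → Extensionality a b) →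
    ∀ {ℓ} (G : Graph ℓ) → Connected G →
    ((¬ SecondCountable G) ⇔ HasUncountableStarDecomposition G) ×
    (HasUncountableStarDecomposition G → UncountablyManyDisjointOpens G)
theorem4p4 em ext G (v , _) =
    mk⇔ (λ ¬sc → Classical.dne em λ no-star → ¬sc (secondCountable ext no-star v))
        (disjointOpens⇒¬secondCountable ∘ star⇒disjointOpens)
  , star⇒disjointOpens
  where open Space G em
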